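{- Let $k\ge 1$ and $r\ge 2$ be integers, let $T$ be a tree on $k+1$ vertices, and let $n$ be a positive integer. If $k>r$, then \[ \mathrm{ex}_r(n,\text{Berge- }T) \leq \frac{2(r-1)}{k}\binom{k}{r}n. \] If $k\le r$, then \[ \mathrm{ex}_r(n,\text{Berge- }T)\le (k-1)n. \]
   Context: All graphs and hypergraphs are finite and simple. A hypergraph $\mathcal{H}$ contains a Berge-$F$ (Berge copy of the graph $F$) if there are an injection $\varphi:V(F)\to V(\mathcal{H})$ and an injection $f:E(F)\to E(\mathcal{H})$ with $\{\varphi(u),\varphi(v)\}\subset f(uv)$ for every edge $uv\in E(F)$; otherwise it is Berge-$F$-free. $\mathrm{ex}_r(n,\text{Berge- }F)$ is the maximum number of hyperedges in an $n$-vertex $r$-uniform Berge-$F$-free hypergraph. -}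

module Defs where

open import Data.Bool using (Bool; true; false; T; T?)
import Data.Bool.Properties as Bool
open import Data.Nat using (ℕ; zero; suc; _^_; _≤_; z≤n)
import Data.Nat.Properties as ℕ
open import Data.Fin using (Fin; zero; suc; inject₁; fromℕ; combine)
import Data.Fin as Fin
import Data.Fin.Properties as Fin
open import Data.Fin.Subset using (Subset; _∈_; ∣_∣; ⊥)
open import Data.Fin.Subset.Properties using (_∈?_; anySubset?)
open import Data.List using (List; []; _∷_; length)
import Data.List as List
open import Data.List.Relation.Unary.All using (All; [])
import Data.List.Relation.Unary.All as All
open import Data.List.Relation.Unary.Unique.Propositional using (Unique)
open import Data.List.Relation.Unary.AllPairs using ([]; _∷_)
import Data.List.Relation.Unary.Unique.DecPropositional as DecUnique
import Data.List.Membership.Propositional as List∈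
import Data.List.Membership.Propositional.Properties as List∈
import Data.List.Membership.DecPropositional as DecList∈
open import Data.Vec using (Vec; []; _∷_)
import Data.Vec as Vec
import Data.Vec.Properties as Vec
open import Data.Product using (Σ; ∃; _×_; _,_; proj₁; proj₂)
open import Function using (_∘_)
open import Function.Definitions using (Injective)
open import Relation.Binary.Construct.Closure.ReflexiveTransitive using (Star)
open import Relation.Binary.Definitions using (DecidableEquality)
open import Relation.Binary.PropositionalEquality
open import Relation.Nullary using (¬_; Dec; yes; no; ¬?; contradiction)
open import Relation.Nullary.Decidable using (map′; _×-dec_; _→-dec_)
open import Relation.Unary using (Decidable)

record Graph (v : ℕ) : Set where
  field
    adj        : Fin v → Fin v → Bool
    adj-sym    : ∀ x y → adj x y ≡ adj y x
    adj-irrefl : ∀ x → adj x x ≡ false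

  Adj : Fin v → Fin v → Set
  Adj x y = T (adj x y)

-- The ordering of the endpoints makes each unordered pair {x , y} occur once.
record Edge {v : ℕ} (G : Graph v) : Set where
  constructor edge
  field
    end₁ end₂ : Fin v
    ordered   : end₁ Fin.< end₂
    adjacent  : Graph.Adj G end₁ end₂

open Edge public

Connected : ∀ {v} → Graph v → Set
Connected G = ∀ x y → Star (Graph.Adj G) x y

-- A cycle on the 3 + ℓ distinct vertices c 0, …, c (2 + ℓ).
record Cycle {v : ℕ} (G : Graph v) : Set where
  field
    ℓ        : ℕ
    c        : Fin (suc (suc (suc ℓ))) → Fin v
    distinct : Injective _≡_ _≡_ c
    step     : ∀ (i : Fin (suc (suc ℓ))) → Graph.Adj G (c (inject₁ i)) (c (suc i))
    close    : Graph.Adj G (c (fromℕ (suc (suc ℓ)))) (c zero)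

Acyclic : ∀ {v} → Graph v → Set
Acyclic G = ¬ Cycle G

-- The graph on zero vertices satisfies this too; to exclude it, use suc k vertices.
record IsTree {v : ℕ} (G : Graph v) : Set where
  field
    connected : Connected G
    acyclic   : Acyclic G

-- The edge set is a duplicate-free list; its order plays no role below.
record Hypergraph (n : ℕ) : Set where
  constructor hypergraph
  field
    edges  : List (Subset n)
    simple : Unique edges

open Hypergraph public

size : ∀ {n} → Hypergraph n → ℕ
size H = length (edges H)

Uniform : ∀ {n} → ℕ → Hypergraph n → Set
Uniform r H = All (λ e → ∣ e ∣ ≡ r) (edges H)

record IsBerge {v n} (F : Graph v) (H : Hypergraph n)
               (φ : Fin v → Fin n) (f : Edge F → Subset n) : Set where
  field
    φ-injective : Injective _≡_ _≡_ φ
    f-injective : Injective _≡_ _≡_ f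
    f-edge      : ∀ e → f e List∈.∈ edges H
    f-contains  : ∀ e → φ (end₁ e) ∈ f e × φ (end₂ e) ∈ f e

BergeCopy : ∀ {v n} → Graph v → Hypergraph n → Set
BergeCopy {v} {n} F H =
  Σ (Fin v → Fin n) λ φ → Σ (Edge F → Subset n) λ f → IsBerge F H φ f

BergeFree : ∀ {v n} → Graph v → Hypergraph n → Set
BergeFree F H = ¬ BergeCopy F H

-- m is the number of hyperedges of some n-vertex r-uniform
-- Berge-F-free hypergraph.
Attained : ∀ {v} → ℕ → ℕ → Graph v → ℕ → Set
Attained r n F m =
  Σ (Hypergraph n) λ H → Uniform r H × BergeFree F H × size H ≡ m

IsMaximum : (ℕ → Set) → ℕ → Set
IsMaximum P m = P m × (∀ j → P j → j ≤ m)

_≟ˢ_ : ∀ {n} → DecidableEquality (Subset n)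
_≟ˢ_ = Vec.≡-dec Bool._≟_

Searchable : Set → Set₁
Searchable A = ∀ {P : A → Set} → Decidable P → Dec (∃ P)

anyVec? : ∀ {A} → Searchable A → ∀ m → Searchable (Vec A m)
anyVec? any zero P? =
  map′ ([] ,_) (λ { ([] , p) → p }) (P? [])
anyVec? any (suc m) P? =
  map′ (λ (x , xs , p) → x ∷ xs , p) (λ { (x ∷ xs , p) → x , xs , p })
       (any λ x → anyVec? any m λ xs → P? (x ∷ xs))

edge-≡ : ∀ {v} {G : Graph v} {d e : Edge G} →
         end₁ d ≡ end₁ e → end₂ d ≡ end₂ e → d ≡ e
edge-≡ {d = edge x y p a} {edge .x .y q b} refl refl =
  cong₂ (edge x y) (Fin.<-irrelevant p q) (Bool.T-irrelevant a b)

_≟ᵉ_ : ∀ {v} {G : Graph v} → DecidableEquality (Edge G)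
d ≟ᵉ e = map′ (λ (p , q) → edge-≡ p q) (λ p → cong end₁ p , cong end₂ p)
              ((end₁ d Fin.≟ end₁ e) ×-dec (end₂ d Fin.≟ end₂ e))

allEdges? : ∀ {v} {G : Graph v} {P : Edge G → Set} →
            Decidable P → Dec (∀ e → P e)
allEdges? {G = G} {P} P? =
  map′ (λ h e → h (end₁ e) (end₂ e) (ordered e) (adjacent e))
       (λ h x y p a → h (edge x y p a))
       (Fin.all? λ x → Fin.all? λ y → at x y)
  where
  at : ∀ x y → Dec (∀ p a → P (edge x y p a))
  at x y with x Fin.<? y | T? (Graph.adj G x y)
  ... | no ¬p | _     = yes λ p → contradiction p ¬p
  ... | yes _ | no ¬a = yes λ _ a → contradiction a ¬a
  ... | yes p | yes a =
    map′ (λ h p′ a′ → subst P (edge-≡ refl refl) h) (λ h → h p a)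
         (P? (edge x y p a))

isBerge? : ∀ {v n} (F : Graph v) (H : Hypergraph n) φ f →
           Dec (IsBerge F H φ f)
isBerge? F H φ f =
  map′ (λ (a , b , c , d) → record
         { φ-injective = λ {x} {y} → a x y
         ; f-injective = λ {x} {y} → b x y
         ; f-edge      = c
         ; f-contains  = d })
       (λ B → (λ x y → IsBerge.φ-injective B) , (λ x y → IsBerge.f-injective B)
            , IsBerge.f-edge B , IsBerge.f-contains B)
       (  (Fin.all? λ x → Fin.all? λ y → (φ x Fin.≟ φ y) →-dec (x Fin.≟ y))
  ×-dec   (allEdges? λ x → allEdges? λ y → (f x ≟ˢ f y) →-dec (x ≟ᵉ y))
  ×-dec   (allEdges? λ e → DecList∈._∈?_ _≟ˢ_ (f e) (edges H))
  ×-dec   (allEdges? λ e → (φ (end₁ e) ∈? f e) ×-dec (φ (end₂ e) ∈? f e)))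

isBerge-resp : ∀ {v n} {F : Graph v} {H : Hypergraph n} {φ φ′ f f′} →
               φ ≗ φ′ → f ≗ f′ → IsBerge F H φ f → IsBerge F H φ′ f′
isBerge-resp {H = H} φ≗ f≗ B = record
  { φ-injective = λ p → φ-injective (trans (φ≗ _) (trans p (sym (φ≗ _))))
  ; f-injective = λ p → f-injective (trans (f≗ _) (trans p (sym (f≗ _))))
  ; f-edge      = λ e → subst (List∈._∈ edges H) (f≗ e) (f-edge e)
  ; f-contains  = λ e → subst₂ _∈_ (φ≗ _) (f≗ e) (proj₁ (f-contains e))
                      , subst₂ _∈_ (φ≗ _) (f≗ e) (proj₂ (f-contains e))
  }
  where open IsBerge B

-- Vertex maps are searched as vectors, and edge maps as v × v matrices of
-- subsets in which the entries away from the edges of F are ignored.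
bergeCopy? : ∀ {v n} (F : Graph v) (H : Hypergraph n) → Dec (BergeCopy F H)
bergeCopy? {v} {n} F H =
  map′ (λ (φ , f , B) → Vec.lookup φ , entry f , B) encode
       (anyVec? Fin.any? v λ φ →
        anyVec? (anyVec? anySubset? v) v λ f →
        isBerge? F H (Vec.lookup φ) (entry f))
  where
  entry : Vec (Vec (Subset n) v) v → Edge F → Subset n
  entry f e = Vec.lookup (Vec.lookup f (end₁ e)) (end₂ e)

  extend : (Edge F → Subset n) → Fin v → Fin v → Subset n
  extend f x y with x Fin.<? y | T? (Graph.adj F x y)
  ... | yes p | yes a = f (edge x y p a)
  ... | yes _ | no  _ = ⊥
  ... | no  _ | _     = ⊥

  extend-edge : ∀ f e → f e ≡ extend f (end₁ e) (end₂ e)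
  extend-edge f (edge x y p a) with x Fin.<? y | T? (Graph.adj F x y)
  ... | yes _ | yes _ = cong f (edge-≡ refl refl)
  ... | yes _ | no ¬a = contradiction a ¬a
  ... | no ¬p | _     = contradiction p ¬p

  matrix : (Edge F → Subset n) → Vec (Vec (Subset n) v) v
  matrix f = Vec.tabulate λ x → Vec.tabulate (extend f x)

  entry-matrix : ∀ f e → f e ≡ entry (matrix f) e
  entry-matrix f e = begin
    f e                                             ≡⟨ extend-edge f e ⟩
    extend f (end₁ e) (end₂ e)                      ≡⟨ Vec.lookup∘tabulate (extend f (end₁ e)) (end₂ e) ⟨
    Vec.lookup (Vec.tabulate (extend f (end₁ e))) (end₂ e)
      ≡⟨ cong (λ row → Vec.lookup row (end₂ e)) (Vec.lookup∘tabulate (λ x → Vec.tabulate (extend f x)) (end₁ e)) ⟨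
    entry (matrix f) e                              ∎
    where open ≡-Reasoning

  encode : BergeCopy F H → _
  encode (φ , f , B) = Vec.tabulate φ , matrix f ,
    isBerge-resp (λ x → sym (Vec.lookup∘tabulate φ x)) (entry-matrix f) B

attained? : ∀ {v} r n (F : Graph v) → Decidable (Attained r n F)
attained? r n F m = map′ to from (anyVec? anySubset? m good?)
  where
  Good : Vec (Subset n) m → Set
  Good es = Σ (Unique (Vec.toList es)) λ u →
    Uniform r (hypergraph _ u) × BergeFree F (hypergraph _ u)

  good? : Decidable Good
  good? es with DecUnique.unique? _≟ˢ_ (Vec.toList es)
  ... | no ¬u = no (¬u ∘ proj₁)
  ... | yes u =
    map′ (u ,_) (λ { (_ , all , free) → all , λ { (φ , f , B) → free (φ , f , reedge B) } })
         (All.all? (λ e → ∣ e ∣ ℕ.≟ r) _ ×-dec ¬? (bergeCopy? F (hypergraph _ u)))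
    where
    reedge : ∀ {φ f u u′} → IsBerge F (hypergraph (Vec.toList es) u) φ f →
             IsBerge F (hypergraph (Vec.toList es) u′) φ f
    reedge B = record { IsBerge B }

  to : ∃ Good → Attained r n F m
  to (es , u , all , free) = hypergraph _ u , all , free , Vec.length-toList es

  from : Attained r n F m → ∃ Good
  from (hypergraph es u , all , free , refl) =
    Vec.fromList es , subst Good′ (sym (Vec.toList∘fromList es)) (u , all , free)
    where
    Good′ : List (Subset n) → Set
    Good′ es = Σ (Unique es) λ u →
      Uniform r (hypergraph _ u) × BergeFree F (hypergraph _ u)

bit : Bool → Fin 2
bit false = zero
bit true  = suc zero

bit-injective : Injective _≡_ _≡_ bit
bit-injective {false} {false} _ = refl
bit-injective {true}  {true}  _ = refl

index : ∀ {n} → Subset n → Fin (2 ^ n)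
index []       = zero
index (b ∷ bs) = combine (bit b) (index bs)

index-injective : ∀ {n} → Injective _≡_ _≡_ (index {n})
index-injective {x = []}     {[]}     _ = refl
index-injective {x = a ∷ as} {b ∷ bs} p
  with q , r ← Fin.combine-injective (bit a) (index as) (bit b) (index bs) p
  = cong₂ _∷_ (bit-injective q) (index-injective r)

lookup-injective : ∀ {A : Set} {xs : List A} → Unique xs →
                   Injective _≡_ _≡_ (List.lookup xs)
lookup-injective (_ ∷ _) {zero}  {zero}  _ = refl
lookup-injective (x ∷ _) {zero}  {suc j} p =
  contradiction p (All.lookup x (List∈.∈-lookup j))
lookup-injective (x ∷ _) {suc i} {zero}  p =
  contradiction (sym p) (All.lookup x (List∈.∈-lookup i))
lookup-injective (_ ∷ u) {suc i} {suc j} p = cong suc (lookup-injective u p)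

size≤2^n : ∀ {n} (H : Hypergraph n) → size H ≤ 2 ^ n
size≤2^n H = Fin.injective⇒≤ (lookup-injective (simple H) ∘ index-injective)

-- The largest j ≤ m with P j, and 0 if there is none.
largest : {P : ℕ → Set} → Decidable P → ℕ → ℕ
largest P? zero = zero
largest P? (suc m) with P? (suc m)
... | yes _ = suc m
... | no  _ = largest P? m

largest-upper : ∀ {P} (P? : Decidable P) m j → P j → j ≤ m → j ≤ largest P? m
largest-upper P? zero    j p j≤m = j≤m
largest-upper P? (suc m) j p j≤m with P? (suc m)
... | yes _ = j≤m
... | no ¬p = largest-upper P? m j p (ℕ.≤-pred (ℕ.≤∧≢⇒< j≤m λ { refl → ¬p p }))

largest-attained : ∀ {P} (P? : Decidable P) m j → P j → j ≤ m → P (largest P? m)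
largest-attained P? zero    .zero p z≤n = p
largest-attained P? (suc m) j p j≤m with P? (suc m)
... | yes q = q
... | no ¬p = largest-attained P? m j p (ℕ.≤-pred (ℕ.≤∧≢⇒< j≤m λ { refl → ¬p p }))

-- ex_r(n, Berge-F).  The bound 2 ^ n loses nothing, by size≤2^n; the value is
-- the maximum whenever F has an edge, by ex-isMaximum.
ex : ∀ {v} → ℕ → ℕ → Graph v → ℕ
ex r n F = largest (attained? r n F) (2 ^ n)

ex-upper : ∀ {v} r n (F : Graph v) m → Attained r n F m → m ≤ ex r n F
ex-upper r n F m a@(H , _ , _ , refl) =
  largest-upper (attained? r n F) (2 ^ n) m a (size≤2^n H)

attained-zero : ∀ {v} r n (F : Graph v) → Edge F → Attained r n F 0
attained-zero r n F e = hypergraph [] [] , [] , free , refl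
  where
  free : BergeFree F (hypergraph [] [])
  free (_ , _ , B) with () ← IsBerge.f-edge B e

ex-isMaximum : ∀ {v} r n (F : Graph v) → Edge F →
               IsMaximum (Attained r n F) (ex r n F)
ex-isMaximum r n F e =
  largest-attained (attained? r n F) (2 ^ n) 0 (attained-zero r n F e) z≤n ,
  ex-upper r n F

{-# OPTIONS --safe #-}

{-
Take a maximum matching between the hyperedges and the pairs of vertices they
contain, and let G be the graph of matched pairs.  A copy of T in G is a Berge
copy of T in the hypergraph, so G is T-free, and hence every nonempty set U of
vertices contains a vertex v with at most k - 1 G-neighbours in U: otherwise T
could be embedded greedily, leaf by leaf.

By König's theorem there is a set W of hyperedges such that every pair inside
a hyperedge of W is matched into W, and every hyperedge outside W is matched.
Replace the hyperedges outside W by their pairs.  If b of the neighbours of v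
come from pairs matched outside W and R from pairs matched into W, then at
most b + C(R, r - 1) of these sets lie in U and contain v.  Removing such
vertices one after the other gives at most c n hyperedges, where c is the
maximum of b + C(R, r - 1) subject to b + R ≤ k - 1.  This is C(k - 1, r - 1)
if r < k and at most k - 1 if k ≤ r; finally k C(k - 1, r - 1) = r C(k, r) and
r ≤ 2 (r - 1).
-}

module Submission where

open import Defs
open import Data.Bool using (true; false; T)
import Data.Bool.Properties as Bool
open import Data.Empty using (⊥-elim)
open import Data.Fin using (Fin; zero; suc; inject₁; fromℕ; opposite)
import Data.Fin as Fin
import Data.Fin.Properties as Fin
open import Data.Fin.Subset
open import Data.Fin.Subset.Induction using (Acc; acc; ⊂-wellFounded; ⊃-wellFounded)
open import Data.Fin.Subset.Properties
import Data.List as List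
import Data.List.Membership.Propositional.Properties as List∈
import Data.List.Relation.Unary.All as All
open import Data.Maybe using (Maybe; just; nothing)
import Data.Maybe.Properties as Maybe
open import Data.Nat using (ℕ; zero; suc; _+_; _*_; _∸_; _≤_; _<_; NonZero; z≤n; s≤s; z<s; s<s)
open import Data.Nat.Combinatorics using (_C_; nCk+nC[k+1]≡[n+1]C[k+1]; nC1≡n; nCn≡1; k>n⇒nCk≡0)
import Data.Nat.Properties as ℕ
open import Data.Product using (Σ; ∃; _×_; _,_; proj₁; proj₂)
open import Data.Sum using (_⊎_; inj₁; inj₂; [_,_]′)
open import Data.Vec using ([]; _∷_; here; there; head; tail; tabulate)
import Data.Vec.Functional as Functional
open import Data.Vec.Properties using (lookup∘tabulate; lookup⇒[]=; []=⇒lookup)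
open import Function using (_∘_)
open import Function.Definitions using (Injective)
open import Relation.Binary.Construct.Closure.ReflexiveTransitive using (Star; ε; _◅_)
open import Relation.Binary.Definitions using (DecidableEquality; tri<; tri≈; tri>)
open import Relation.Binary.PropositionalEquality
open import Relation.Nullary using (¬_; Dec; yes; no; does; proof; ¬?; contradiction; invert; Reflects)
open import Relation.Nullary.Decidable using (_×-dec_; dec-true; decidable-stable)
open import Relation.Unary using (Decidable)

-- Cardinalities of subsets

private variable
  m n : ℕ

comprehension : {P : Fin n → Set} → Decidable P → Subset n
comprehension P? = tabulate (does ∘ P?)

module _ {P : Fin n → Set} (P? : Decidable P) where

  ∈-comprehension⁺ : ∀ {x} → P x → x ∈ comprehension P?
  ∈-comprehension⁺ {x} px =
    lookup⇒[]= x _ (trans (lookup∘tabulate (does ∘ P?) x) (dec-true (P? x) px))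

  ∈-comprehension⁻ : ∀ {x} → x ∈ comprehension P? → P x
  ∈-comprehension⁻ {x} x∈ = invert (subst (Reflects (P x))
    (trans (sym (lookup∘tabulate (does ∘ P?) x)) ([]=⇒lookup x∈)) (proof (P? x)))

-- With `rank` this identifies `p` with `Fin ∣ p ∣`, so that cardinalities can be compared by the
-- pigeonhole principle for `Fin`.
enum : (p : Subset n) → Fin ∣ p ∣ → Fin n
enum (true  ∷ p) zero    = zero
enum (true  ∷ p) (suc i) = suc (enum p i)
enum (false ∷ p) i       = suc (enum p i)

enum-∈ : (p : Subset n) (i : Fin ∣ p ∣) → enum p i ∈ p
enum-∈ (true  ∷ p) zero    = here
enum-∈ (true  ∷ p) (suc i) = there (enum-∈ p i)
enum-∈ (false ∷ p) i       = there (enum-∈ p i)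

enum-injective : (p : Subset n) {i j : Fin ∣ p ∣} → enum p i ≡ enum p j → i ≡ j
enum-injective (true  ∷ p) {zero}  {zero}  eq = refl
enum-injective (true  ∷ p) {suc i} {suc j} eq = cong suc (enum-injective p (Fin.suc-injective eq))
enum-injective (false ∷ p) {i}     {j}     eq = enum-injective p (Fin.suc-injective eq)

rank : {p : Subset n} {x : Fin n} → x ∈ p → Fin ∣ p ∣
rank                  here       = zero
rank {p = true  ∷ _} (there x∈p) = suc (rank x∈p)
rank {p = false ∷ _} (there x∈p) = rank x∈p

rank-injective : {p : Subset n} {x y : Fin n} (x∈p : x ∈ p) (y∈p : y ∈ p) →
                 rank x∈p ≡ rank y∈p → x ≡ y
rank-injective                 here        here        eq = refl
rank-injective {p = true  ∷ _} (there x∈p) (there y∈p) eq =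
  cong suc (rank-injective x∈p y∈p (Fin.suc-injective eq))
rank-injective {p = false ∷ _} (there x∈p) (there y∈p) eq =
  cong suc (rank-injective x∈p y∈p eq)

-- Images are chosen through `enum`. A relation suffices in place of a map: it may have several
-- values, and nothing is asked of it outside `p`.
∣p∣≤∣q∣-injection : {p : Subset m} {q : Subset n} (R : Fin m → Fin n → Set) →
  (∀ {x} → x ∈ p → ∃ λ y → y ∈ q × R x y) →
  (∀ {x x′ y} → x ∈ p → x′ ∈ p → R x y → R x′ y → x ≡ x′) →
  ∣ p ∣ ≤ ∣ q ∣
∣p∣≤∣q∣-injection {p = p} {q} R total injective = Fin.injective⇒≤ {f = to} to-injective
  where
  image : ∀ i → ∃ λ y → y ∈ q × R (enum p i) y
  image i = total (enum-∈ p i)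

  to : Fin ∣ p ∣ → Fin ∣ q ∣
  to i = rank (proj₁ (proj₂ (image i)))

  to-injective : ∀ {i j} → to i ≡ to j → i ≡ j
  to-injective {i} {j} eq
    with y≡y′ ← rank-injective (proj₁ (proj₂ (image i))) (proj₁ (proj₂ (image j))) eq =
    enum-injective p (injective (enum-∈ p i) (enum-∈ p j) (proj₂ (proj₂ (image i)))
      (subst (R (enum p j)) (sym y≡y′) (proj₂ (proj₂ (image j)))))

∣p∣≡∣p∩q∣+∣p∩∁q∣ : (p q : Subset n) → ∣ p ∣ ≡ ∣ p ∩ q ∣ + ∣ p ∩ ∁ q ∣
∣p∣≡∣p∩q∣+∣p∩∁q∣ []          []          = refl
∣p∣≡∣p∩q∣+∣p∩∁q∣ (true  ∷ p) (true  ∷ q) = cong suc (∣p∣≡∣p∩q∣+∣p∩∁q∣ p q)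
∣p∣≡∣p∩q∣+∣p∩∁q∣ (true  ∷ p) (false ∷ q) =
  trans (cong suc (∣p∣≡∣p∩q∣+∣p∩∁q∣ p q)) (sym (ℕ.+-suc _ _))
∣p∣≡∣p∩q∣+∣p∩∁q∣ (false ∷ p) (_     ∷ q) = ∣p∣≡∣p∩q∣+∣p∩∁q∣ p q

∣p∣≡0⇒x∉p : {p : Subset n} {x : Fin n} → ∣ p ∣ ≡ 0 → x ∉ p
∣p∣≡0⇒x∉p {p = p} ∣p∣≡0 x∈p with () ← subst Fin ∣p∣≡0 (rank x∈p)

∣p∣≡suc⇒Nonempty : ∀ {s} (p : Subset n) → ∣ p ∣ ≡ suc s → Nonempty p
∣p∣≡suc⇒Nonempty p eq = enum p i , enum-∈ p i
  where i = subst Fin (sym eq) zero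

x∉p-x : (p : Subset n) (x : Fin n) → x ∉ p - x
x∉p-x (_ ∷ p) (suc x) (there x∈) = x∉p-x p x x∈

x∈p⇒1+∣p-x∣≡∣p∣ : {p : Subset n} {x : Fin n} → x ∈ p → suc ∣ p - x ∣ ≡ ∣ p ∣
x∈p⇒1+∣p-x∣≡∣p∣ {p = true  ∷ p} here        = cong (suc ∘ ∣_∣) (p─⊥≡p p)
x∈p⇒1+∣p-x∣≡∣p∣ {p = true  ∷ p} (there x∈p) = cong suc (x∈p⇒1+∣p-x∣≡∣p∣ x∈p)
x∈p⇒1+∣p-x∣≡∣p∣ {p = false ∷ p} (there x∈p) = x∈p⇒1+∣p-x∣≡∣p∣ x∈p

x∈p-y⁻ : (p : Subset n) {x y : Fin n} → x ∈ p - y → x ∈ p × x ≢ y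
x∈p-y⁻ p {x} x∈ = p─q⊆p p _ x∈ , λ { refl → x∉p-x p x x∈ }

∈-add⁻ : {p : Subset n} {x y : Fin n} → x ∈ p ∪ ⁅ y ⁆ → x ∈ p ⊎ x ≡ y
∈-add⁻ {p = p} {y = y} x∈ = [ inj₁ , inj₂ ∘ x∈⁅y⁆⇒x≡y y ]′ (x∈p∪q⁻ p ⁅ y ⁆ x∈)

-- Two-element subsets

pair : Fin n → Fin n → Subset n
pair x y = ⁅ x ⁆ ∪ ⁅ y ⁆

x∈pair : (x y : Fin n) → x ∈ pair x y
x∈pair x y = p⊆p∪q ⁅ y ⁆ (x∈⁅x⁆ x)

y∈pair : (x y : Fin n) → y ∈ pair x y
y∈pair x y = q⊆p∪q ⁅ x ⁆ ⁅ y ⁆ (x∈⁅x⁆ y)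

∈-pair⁻ : {x y z : Fin n} → z ∈ pair x y → z ≡ x ⊎ z ≡ y
∈-pair⁻ {x = x} {y} z∈ =
  [ inj₁ ∘ x∈⁅y⁆⇒x≡y x , inj₂ ∘ x∈⁅y⁆⇒x≡y y ]′ (x∈p∪q⁻ ⁅ x ⁆ ⁅ y ⁆ z∈)

pair⊆ : {p : Subset n} {x y : Fin n} → x ∈ p → y ∈ p → pair x y ⊆ p
pair⊆ x∈p y∈p z∈ with ∈-pair⁻ z∈
... | inj₁ refl = x∈p
... | inj₂ refl = y∈p

pair-comm : (x y : Fin n) → pair x y ≡ pair y x
pair-comm x y = ⊆-antisym (pair⊆ (y∈pair y x) (x∈pair y x)) (pair⊆ (y∈pair x y) (x∈pair x y))

∣pair∣≡2 : {x y : Fin n} → x ≢ y → ∣ pair x y ∣ ≡ 2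
∣pair∣≡2 {x = x} {y} x≢y = begin
  ∣ pair x y ∣           ≡⟨ x∈p⇒1+∣p-x∣≡∣p∣ (x∈pair x y) ⟨
  suc ∣ pair x y - x ∣   ≡⟨ cong (suc ∘ ∣_∣) (⊆-antisym to from) ⟩
  suc ∣ ⁅ y ⁆ ∣          ≡⟨ cong suc (∣⁅x⁆∣≡1 y) ⟩
  2                      ∎
  where
  open ≡-Reasoning
  to : pair x y - x ⊆ ⁅ y ⁆
  to z∈ with z∈pair , z≢x ← x∈p-y⁻ (pair x y) z∈ with ∈-pair⁻ z∈pair
  ... | inj₁ z≡x  = contradiction z≡x z≢x
  ... | inj₂ refl = x∈⁅x⁆ _
  from : ⁅ y ⁆ ⊆ pair x y - x
  from z∈ with refl ← x∈⁅y⁆⇒x≡y y z∈ = x∈p∧x≢y⇒x∈p-y (y∈pair x y) (x≢y ∘ sym)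

∣p∣≡2⇒pair : {p : Subset n} {x : Fin n} → ∣ p ∣ ≡ 2 → x ∈ p →
             ∃ λ y → y ≢ x × p ≡ pair x y
∣p∣≡2⇒pair {p = p} {x} ∣p∣≡2 x∈p = y , y≢x , ⊆-antisym to (pair⊆ x∈p y∈p)
  where
  ∣p-x∣≡1 : ∣ p - x ∣ ≡ 1
  ∣p-x∣≡1 = ℕ.suc-injective (trans (x∈p⇒1+∣p-x∣≡∣p∣ x∈p) ∣p∣≡2)
  other = ∣p∣≡suc⇒Nonempty (p - x) ∣p-x∣≡1
  y   = proj₁ other
  y∈p = proj₁ (x∈p-y⁻ p (proj₂ other))
  y≢x = proj₂ (x∈p-y⁻ p (proj₂ other))
  to : p ⊆ pair x y
  to {z} z∈p with z Fin.≟ x | z Fin.≟ y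
  ... | yes refl | _        = x∈pair x y
  ... | no _     | yes refl = y∈pair x y
  -- A third element would survive the removal of both `x` and `y` from a set of size two.
  ... | no z≢x   | no z≢y   = contradiction
    (x∈p∧x≢y⇒x∈p-y (x∈p∧x≢y⇒x∈p-y z∈p z≢x) z≢y)
    (∣p∣≡0⇒x∉p (ℕ.suc-injective (trans (x∈p⇒1+∣p-x∣≡∣p∣ (proj₂ other)) ∣p-x∣≡1)))

-- Counting sets of fixed size

module _ {n : ℕ} where

  head≡inside : (p : Subset (suc n)) → head p ≡ inside → ∣ p ∣ ≡ suc ∣ tail p ∣
  head≡inside (true ∷ _) _ = refl

  head≢inside : (p : Subset (suc n)) → head p ≢ inside → ∣ p ∣ ≡ ∣ tail p ∣
  head≢inside (true  ∷ _) h = contradiction refl h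
  head≢inside (false ∷ _) _ = refl

  head∷tail-≡ : {p q : Subset (suc n)} → head p ≡ head q → tail p ≡ tail q → p ≡ q
  head∷tail-≡ {_ ∷ _} {_ ∷ _} refl refl = refl

  tail-⊆ : {p q : Subset (suc n)} → p ⊆ q → tail p ⊆ tail q
  tail-⊆ {_ ∷ _} {_ ∷ _} p⊆q = drop-∷-⊆ p⊆q

  head-outside : {p : Subset (suc n)} {q : Subset n} → p ⊆ outside ∷ q → head p ≢ inside
  head-outside {true ∷ _} p⊆q refl with () ← p⊆q here

-- Induction on `N` by Pascal's rule: the members that contain the first point of `N` and those that
-- avoid it are counted separately, each by its tails.
∣family∣≤C : (N : Subset n) (s : ℕ) (F : Subset m) (t : Fin m → Subset n) →
  (∀ {a} → a ∈ F → t a ⊆ N) →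
  (∀ {a} → a ∈ F → ∣ t a ∣ ≡ s) →
  (∀ {a b} → a ∈ F → b ∈ F → t a ≡ t b → a ≡ b) →
  ∣ F ∣ ≤ ∣ N ∣ C s
-- Every member is the empty set, so injectivity leaves at most one index, and `0 C 0` is 1.
∣family∣≤C [] zero F t _ _ t-inj =
  ∣p∣≤∣q∣-injection {q = ⊤ {1}} (λ _ y → y ≡ zero) (λ _ → zero , ∈⊤ , refl)
    λ a∈ b∈ _ _ → t-inj a∈ b∈ (empty≡ _ _)
  where
  empty≡ : (p q : Subset 0) → p ≡ q
  empty≡ [] [] = refl
∣family∣≤C [] (suc s) F t _ size _ =
  ∣p∣≤∣q∣-injection {q = []} (λ _ _ → Fin 0)
    (λ {a} a∈ → contradiction (size a∈) (empty (t a))) λ _ _ ()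
  where
  empty : (p : Subset 0) → ∣ p ∣ ≢ suc s
  empty [] ()
∣family∣≤C (false ∷ N) s F t sub size t-inj =
  ∣family∣≤C N s F (tail ∘ t) (λ a∈ → tail-⊆ (sub a∈))
    (λ a∈ → trans (sym (head≢inside (t _) (head-outside (sub a∈)))) (size a∈))
    λ a∈ b∈ eq → t-inj a∈ b∈ (head∷tail-≡
      (trans (Bool.¬-not (head-outside (sub a∈))) (sym (Bool.¬-not (head-outside (sub b∈))))) eq)
∣family∣≤C {m = m} (true ∷ N) s F t sub size t-inj = split s size
  where
  inside? : Decidable (λ a → head (t a) ≡ inside)
  inside? a = head (t a) Bool.≟ inside

  H : Subset m
  H = comprehension inside?

  with-head : ∀ {a} → a ∈ F ∩ H → a ∈ F × head (t a) ≡ inside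
  with-head a∈ with a∈F , a∈H ← x∈p∩q⁻ F H a∈ = a∈F , ∈-comprehension⁻ inside? a∈H

  without-head : ∀ {a} → a ∈ F ∩ ∁ H → a ∈ F × head (t a) ≢ inside
  without-head a∈ with a∈F , a∈∁H ← x∈p∩q⁻ F (∁ H) a∈ =
    a∈F , x∈∁p⇒x∉p a∈∁H ∘ ∈-comprehension⁺ inside?

  bound-with : ∀ s → (∀ {a} → a ∈ F → ∣ t a ∣ ≡ suc s) → ∣ F ∩ H ∣ ≤ ∣ N ∣ C s
  bound-with s size = ∣family∣≤C N s (F ∩ H) (tail ∘ t) (tail-⊆ ∘ sub ∘ proj₁ ∘ with-head)
    (λ a∈ → ℕ.suc-injective (trans (sym (head≡inside (t _) (proj₂ (with-head a∈)))) (size (proj₁ (with-head a∈)))))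
    λ a∈ b∈ eq → t-inj (proj₁ (with-head a∈)) (proj₁ (with-head b∈))
      (head∷tail-≡ (trans (proj₂ (with-head a∈)) (sym (proj₂ (with-head b∈)))) eq)

  bound-without : ∀ s → (∀ {a} → a ∈ F → ∣ t a ∣ ≡ s) → ∣ F ∩ ∁ H ∣ ≤ ∣ N ∣ C s
  bound-without s size = ∣family∣≤C N s (F ∩ ∁ H) (tail ∘ t) (tail-⊆ ∘ sub ∘ proj₁ ∘ without-head)
    (λ a∈ → trans (sym (head≢inside (t _) (proj₂ (without-head a∈)))) (size (proj₁ (without-head a∈))))
    λ a∈ b∈ eq → t-inj (proj₁ (without-head a∈)) (proj₁ (without-head b∈))
      (head∷tail-≡ (trans (Bool.¬-not (proj₂ (without-head a∈)))
                          (sym (Bool.¬-not (proj₂ (without-head b∈))))) eq)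

  split : ∀ s → (∀ {a} → a ∈ F → ∣ t a ∣ ≡ s) → ∣ F ∣ ≤ suc ∣ N ∣ C s
  -- A set of size 0 cannot contain the head, so the whole family falls into the second class.
  split zero size = ℕ.≤-trans (p⊆q⇒∣p∣≤∣q∣ F⊆) (bound-without zero size)
    where
    F⊆ : F ⊆ F ∩ ∁ H
    F⊆ a∈F = x∈p∩q⁺ (a∈F , x∉p⇒x∈∁p λ a∈H →
      ℕ.0≢1+n (trans (sym (size a∈F)) (head≡inside (t _) (∈-comprehension⁻ inside? a∈H))))
  split (suc s) size = begin
    ∣ F ∣                          ≡⟨ ∣p∣≡∣p∩q∣+∣p∩∁q∣ F H ⟩
    ∣ F ∩ H ∣ + ∣ F ∩ ∁ H ∣        ≤⟨ ℕ.+-mono-≤ (bound-with s size) (bound-without (suc s) size) ⟩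
    ∣ N ∣ C s + ∣ N ∣ C suc s      ≡⟨ nCk+nC[k+1]≡[n+1]C[k+1] ∣ N ∣ s ⟩
    suc ∣ N ∣ C suc s              ∎
    where open ℕ.≤-Reasoning

-- König's theorem

module König {B : Set} (_≟_ : DecidableEquality B) (search : Searchable B)
             {m : ℕ} {R : Fin m → B → Set} (R? : ∀ a → Decidable (R a)) where

  record Matching : Set where
    field
      partner   : Fin m → Maybe B
      sound     : ∀ {a b} → partner a ≡ just b → R a b
      injective : ∀ {a a′ b} → partner a ≡ just b → partner a′ ≡ just b → a ≡ a′

  open Matching

  Free : Matching → Fin m → Set
  Free M a = partner M a ≡ nothing

  free? : ∀ M → Decidable (Free M)
  free? M a = Maybe.≡-dec _≟_ (partner M a) nothing

  free : Matching → Subset m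
  free M = comprehension (free? M)

  Hit : Matching → Subset m → B → Set
  Hit M W b = ∃ λ a → a ∈ W × partner M a ≡ just b

  hit? : ∀ M W → Decidable (Hit M W)
  hit? M W b = Fin.any? λ a → (a ∈? W) ×-dec Maybe.≡-dec _≟_ (partner M a) (just b)

  -- The complement of W together with the partners of W is a vertex cover of
  -- R that meets every edge of the matching exactly once.
  record Cover : Set where
    field
      M      : Matching
      W      : Subset m
      free⊆W : ∀ {a} → Free M a → a ∈ W
      closed : ∀ {a b} → a ∈ W → R a b → Hit M W b

  update : (Fin m → Maybe B) → Fin m → Maybe B → Fin m → Maybe B
  update μ a x a′ with a′ Fin.≟ a
  ... | yes _ = x
  ... | no  _ = μ a′

  update⁻ : ∀ μ a x a′ {y} → update μ a x a′ ≡ y → (a′ ≡ a × x ≡ y) ⊎ (a′ ≢ a × μ a′ ≡ y)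
  update⁻ μ a x a′ eq with a′ Fin.≟ a
  ... | yes a′≡a = inj₁ (a′≡a , eq)
  ... | no  a′≢a = inj₂ (a′≢a , eq)

  update-same : ∀ μ a x → update μ a x a ≡ x
  update-same μ a x with a Fin.≟ a
  ... | yes _  = refl
  ... | no a≢a = contradiction refl a≢a

  update-other : ∀ μ a x {a′} → a′ ≢ a → update μ a x a′ ≡ μ a′
  update-other μ a x {a′} a′≢a with a′ Fin.≟ a
  ... | yes a′≡a = contradiction a′≡a a′≢a
  ... | no  _    = refl

  vacate : Matching → Fin m → Matching
  vacate M a = record
    { partner   = update (partner M) a nothing
    ; sound     = sound M ∘ kept
    ; injective = λ p q → injective M (kept p) (kept q)
    }
    where
    kept : ∀ {a′ b} → update (partner M) a nothing a′ ≡ just b → partner M a′ ≡ just b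
    kept {a′} eq with update⁻ (partner M) a nothing a′ eq
    ... | inj₂ (_ , p) = p

  assign : (M : Matching) (a : Fin m) (b : B) → R a b →
           (∀ a′ → partner M a′ ≢ just b) → Matching
  assign M a b Rab fresh = record
    { partner   = μ
    ; sound     = λ {a′} eq → sound′ (update⁻ (partner M) a (just b) a′ eq)
    ; injective = λ {a₁} {a₂} p q → injective′ (update⁻ (partner M) a (just b) a₁ p)
                                              (update⁻ (partner M) a (just b) a₂ q)
    }
    where
    μ = update (partner M) a (just b)
    Cases : Fin m → B → Set
    Cases a′ b′ = (a′ ≡ a × just b ≡ just b′) ⊎ (a′ ≢ a × partner M a′ ≡ just b′)
    sound′ : ∀ {a′ b′} → Cases a′ b′ → R a′ b′
    sound′ (inj₁ (refl , refl)) = Rab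
    sound′ (inj₂ (_ , p))       = sound M p
    injective′ : ∀ {a₁ a₂ b′} → Cases a₁ b′ → Cases a₂ b′ → a₁ ≡ a₂
    injective′ (inj₁ (refl , _))    (inj₁ (refl , _))    = refl
    injective′ (inj₁ (_ , refl))    (inj₂ (_ , p))       = contradiction p (fresh _)
    injective′ (inj₂ (_ , p))       (inj₁ (_ , refl))    = contradiction p (fresh _)
    injective′ (inj₂ (_ , p))       (inj₂ (_ , q))       = injective M p q

  -- The result of shifting M along an alternating path inside W that starts at
  -- the free element root and ends at a.
  record Shift (M : Matching) (W : Subset m) (a : Fin m) : Set where
    field
      M′        : Matching
      vacated   : Free M′ a
      agrees    : ∀ {a′} → a′ ∉ W → partner M′ a′ ≡ partner M a′
      hits      : ∀ {a′ b} → a′ ∈ W → partner M′ a′ ≡ just b → Hit M W b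
      root      : Fin m
      root-free : Free M root
      free⁻     : ∀ {a′} → Free M′ a′ → a′ ≡ a ⊎ (Free M a′ × a′ ≢ root)

  trivial-shift : ∀ M a → Free M a → Shift M (free M) a
  trivial-shift M a a-free = record
    { M′ = M ; vacated = a-free ; agrees = λ _ → refl ; hits = λ a′∈ p → _ , a′∈ , p
    ; root = a ; root-free = a-free ; free⁻ = free⁻ }
    where
    free⁻ : ∀ {a′} → Free M a′ → a′ ≡ a ⊎ (Free M a′ × a′ ≢ a)
    free⁻ {a′} p with a′ Fin.≟ a
    ... | yes a′≡a = inj₁ a′≡a
    ... | no  a′≢a = inj₂ (p , a′≢a)

  -- The shift frees `a` at the cost of matching `root`; giving `b` to `a` then leaves one free
  -- element fewer.
  augment : ∀ {M W a b} → Shift M W a → R a b →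
            (∀ a′ → partner M a′ ≢ just b) → ∃ λ M″ → free M″ ⊂ free M
  augment {M} {W} {a} {b} S Rab fresh = M″ , (λ x∈ → ∈-comprehension⁺ (free? M) (proj₁ (free″ x∈))) ,
    root , ∈-comprehension⁺ (free? M) root-free , λ x∈ → proj₂ (free″ x∈) refl
    where
    open Shift S
    fresh′ : ∀ a′ → partner M′ a′ ≢ just b
    fresh′ a′ p with a′ ∈? W
    ... | yes a′∈W = let w , _ , q = hits a′∈W p in fresh w q
    ... | no  a′∉W = fresh a′ (trans (sym (agrees a′∉W)) p)
    M″ : Matching
    M″ = assign M′ a b Rab fresh′
    free″ : ∀ {x} → x ∈ free M″ → Free M x × x ≢ root
    free″ {x} x∈ with update⁻ (partner M′) a (just b) x (∈-comprehension⁻ (free? M″) x∈)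
    ... | inj₂ (x≢a , p) with free⁻ p
    ...   | inj₁ x≡a = contradiction x≡a x≢a
    ...   | inj₂ q   = q

  module Extend {M : Matching} {W : Subset m} {a a′ : Fin m} {b : B} (Rab : R a b)
                (¬hit : ¬ Hit M W b) (match : partner M a′ ≡ just b) where

    W⁺ : Subset m
    W⁺ = W ∪ ⁅ a′ ⁆

    a′∉W : a′ ∉ W
    a′∉W a′∈W = ¬hit (a′ , a′∈W , match)

    a′∈W⁺ : a′ ∈ W⁺
    a′∈W⁺ = q⊆p∪q W ⁅ a′ ⁆ (x∈⁅x⁆ a′)

    W⊆W⁺ : W ⊆ W⁺
    W⊆W⁺ = p⊆p∪q ⁅ a′ ⁆

    hit⁺ : ∀ {c} → Hit M W c → Hit M W⁺ c
    hit⁺ (w , w∈W , p) = w , W⊆W⁺ w∈W , p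

    -- As `a′` lies outside `W`, the shift leaves its partner as in `M`, which is what `hits`
    -- demands of the new element.
    weaken : ∀ {x} → Shift M W x → Shift M W⁺ x
    weaken S = record
      { Shift S hiding (agrees; hits)
      ; agrees = λ x∉ → agrees (x∉ ∘ W⊆W⁺)
      ; hits   = λ x∈ p → hits⁺ (∈-add⁻ x∈) p }
      where
      open Shift S
      hits⁺ : ∀ {x c} → x ∈ W ⊎ x ≡ a′ → partner M′ x ≡ just c → Hit M W⁺ c
      hits⁺ (inj₁ x∈W)  p = hit⁺ (hits x∈W p)
      hits⁺ (inj₂ refl) p = a′ , a′∈W⁺ , trans (sym (agrees a′∉W)) p

    -- The alternating path continues through `b`: this label passes from `a′` to `a`, which the
    -- shift has vacated, and `a′` becomes free instead.
    lengthen : a ∈ W → Shift M W a → Shift M W⁺ a′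
    lengthen a∈W S = record
      { M′        = M″
      ; vacated   = trans (update-other (partner V) a (just b) a′≢a) (update-same (partner M′) a′ nothing)
      ; agrees    = λ {x} x∉ → trans (update-other (partner V) a (just b) {x} λ { refl → x∉ (W⊆W⁺ a∈W) })
                      (trans (update-other (partner M′) a′ nothing {x} λ { refl → x∉ a′∈W⁺ }) (agrees (x∉ ∘ W⊆W⁺)))
      ; hits      = λ {x} x∈ p → hits″ (∈-add⁻ x∈) (update⁻ (partner V) a (just b) x p)
      ; root      = root
      ; root-free = root-free
      ; free⁻     = λ {x} p → free″ (update⁻ (partner V) a (just b) x p)
      }
      where
      open Shift S
      a′≢a : a′ ≢ a
      a′≢a refl = a′∉W a∈W
      match′ : partner M′ a′ ≡ just b
      match′ = trans (agrees a′∉W) match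
      V : Matching
      V = vacate M′ a′
      fresh : ∀ x → partner V x ≢ just b
      fresh x p with update⁻ (partner M′) a′ nothing x p
      ... | inj₂ (x≢a′ , q) = x≢a′ (injective M′ q match′)
      M″ : Matching
      M″ = assign V a b Rab fresh
      hits″ : ∀ {x c} → x ∈ W ⊎ x ≡ a′ →
        (x ≡ a × just b ≡ just c) ⊎ (x ≢ a × partner V x ≡ just c) → Hit M W⁺ c
      hits″ _ (inj₁ (_ , refl)) = a′ , a′∈W⁺ , match
      hits″ {x} x∈ (inj₂ (_ , p)) with update⁻ (partner M′) a′ nothing x p
      hits″ (inj₁ x∈W)  _ | inj₂ (_ , q)    = hit⁺ (hits x∈W q)
      hits″ (inj₂ x≡a′) _ | inj₂ (x≢a′ , _) = contradiction x≡a′ x≢a′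
      free″ : ∀ {x} → (x ≡ a × just b ≡ nothing) ⊎ (x ≢ a × Free V x) →
              x ≡ a′ ⊎ (Free M x × x ≢ root)
      free″ {x} (inj₂ (x≢a , p)) with update⁻ (partner M′) a′ nothing x p
      ... | inj₁ (x≡a′ , _) = inj₁ x≡a′
      ... | inj₂ (_ , q) with free⁻ q
      ...   | inj₁ x≡a = contradiction x≡a x≢a
      ...   | inj₂ r   = inj₂ r

    shifts : a ∈ W → (∀ {x} → x ∈ W → Shift M W x) → ∀ {x} → x ∈ W⁺ → Shift M W⁺ x
    shifts a∈W S x∈ with ∈-add⁻ x∈
    ... | inj₁ x∈W  = weaken (S x∈W)
    ... | inj₂ refl = lengthen a∈W (S a∈W)

  -- Alternating search from the free elements; the invariant is that every element of `W` can be
  -- freed by a shift. A label related to `W` but not hit by it is either unmatched, which gives an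
  -- augmentation and a restart, or matched to an element outside `W`, which then joins `W`. When no
  -- such label is left, `W` is closed.
  explore : ∀ M → (∀ M′ → free M′ ⊂ free M → Cover) →
            ∀ W → Acc _⊃_ W → (∀ {a} → Free M a → a ∈ W) →
            (∀ {a} → a ∈ W → Shift M W a) → Cover
  explore M restart W (acc rec) free⊆W S
    with Fin.any? (λ a → (a ∈? W) ×-dec search (λ b → R? a b ×-dec ¬? (hit? M W b)))
  ... | no done = record
    { M = M ; W = W ; free⊆W = free⊆W
    ; closed = λ a∈W Rab → decidable-stable (hit? M W _) λ ¬hit → done (_ , a∈W , _ , Rab , ¬hit) }
  ... | yes (a , a∈W , b , Rab , ¬hit)
    with Fin.any? (λ a′ → Maybe.≡-dec _≟_ (partner M a′) (just b))
  ...   | no fresh =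
    let M″ , smaller = augment (S a∈W) Rab λ a′ p → fresh (a′ , p) in restart M″ smaller
  ...   | yes (a′ , match) =
    explore M restart W⁺ (rec (W⊆W⁺ , a′ , a′∈W⁺ , a′∉W)) (W⊆W⁺ ∘ free⊆W) (shifts a∈W S)
    where open Extend {M} {W} {a} {a′} {b} Rab ¬hit match

  abstract
    cover : Cover
    cover = improve empty (⊂-wellFounded (free empty))
      where
      empty : Matching
      empty = record { partner = λ _ → nothing ; sound = λ () ; injective = λ () }
      improve : ∀ M → Acc _⊂_ (free M) → Cover
      improve M (acc rec) = explore M (λ M′ lt → improve M′ (rec lt)) (free M)
        (⊃-wellFounded (free M)) (∈-comprehension⁺ (free? M))
        (λ {a} a∈ → trivial-shift M a (∈-comprehension⁻ (free? M) a∈))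

-- Embedding trees

opposite-inject₁ : ∀ {n} (i : Fin n) → opposite (inject₁ i) ≡ suc (opposite i)
opposite-inject₁ zero    = refl
opposite-inject₁ (suc i) = cong inject₁ (opposite-inject₁ i)

opposite-injective : ∀ {n} {i j : Fin n} → opposite i ≡ opposite j → i ≡ j
opposite-injective {i = i} {j} eq = begin
  i                       ≡⟨ Fin.opposite-involutive i ⟨
  opposite (opposite i)   ≡⟨ cong opposite eq ⟩
  opposite (opposite j)   ≡⟨ Fin.opposite-involutive j ⟩
  j                       ∎
  where open ≡-Reasoning

-- Walks and paths in a graph

module _ {v : ℕ} (G : Graph v) where
  open Graph G

  Adj-sym : ∀ {x y} → Adj x y → Adj y x
  Adj-sym {x} {y} = subst T (adj-sym x y)

  Adj⇒≢ : ∀ {x y} → Adj x y → x ≢ y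
  Adj⇒≢ {x} x~x refl = subst T (adj-irrefl x) x~x

  -- The first step of the walk that leaves `P`.
  crossing : ∀ {P : Subset v} {x y} → Star Adj x y → x ∈ P → y ∉ P →
             ∃ λ a → ∃ λ b → a ∈ P × b ∉ P × Adj a b
  crossing ε x∈P y∉P = contradiction x∈P y∉P
  crossing {P} {x} (_◅_ {j = z} x~z z⋯y) x∈P y∉P with z ∈? P
  ... | yes z∈P = crossing z⋯y z∈P y∉P
  ... | no  z∉P = x , z , x∈P , z∉P , x~z

  -- The vertices are listed as in `Cycle`, so that a path with adjacent ends is turned into a cycle
  -- field by field.
  record Path (P : Subset v) (x y : Fin v) : Set where
    field
      ℓ        : ℕ
      c        : Fin (suc ℓ) → Fin v
      start    : c zero ≡ x
      end      : c (fromℕ ℓ) ≡ y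
      distinct : Injective _≡_ _≡_ c
      inside-P : ∀ i → c i ∈ P
      step     : ∀ i → Adj (c (inject₁ i)) (c (suc i))

  open Path

  single : ∀ {P x} → x ∈ P → Path P x x
  single {x = x} x∈P = record
    { ℓ = 0 ; c = λ _ → x ; start = refl ; end = refl
    ; distinct = λ { {zero} {zero} _ → refl } ; inside-P = λ _ → x∈P ; step = λ () }

  reverse : ∀ {P x y} → Path P x y → Path P y x
  reverse p = record
    { ℓ        = ℓ p
    ; c        = c p ∘ opposite
    ; start    = end p
    ; end      = trans (cong (c p) (Fin.opposite-involutive zero)) (start p)
    ; distinct = opposite-injective ∘ distinct p
    ; inside-P = inside-P p ∘ opposite
    ; step     = λ i → subst (λ j → Adj (c p j) (c p (inject₁ (opposite i))))
                         (sym (opposite-inject₁ i)) (Adj-sym (step p (opposite i)))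
    }

  weaken-path : ∀ {P Q x y} → P ⊆ Q → Path P x y → Path Q x y
  weaken-path P⊆Q p = record { Path p hiding (inside-P) ; inside-P = λ i → P⊆Q (inside-P p i) }

  prepend : ∀ {P x y z} → z ∉ P → Adj z x → Path P x y → Path (P ∪ ⁅ z ⁆) z y
  prepend {P} {x} {y} {z} z∉P z~x p = record
    { ℓ = suc (ℓ p) ; c = c′ ; start = refl ; end = end p ; distinct = distinct′
    ; inside-P = inside′ ; step = step′ }
    where
    c′ = z Functional.∷ c p
    distinct′ : Injective _≡_ _≡_ c′
    distinct′ {zero}  {zero}  _  = refl
    distinct′ {zero}  {suc j} eq = contradiction (subst (_∈ P) (sym eq) (inside-P p j)) z∉P
    distinct′ {suc i} {zero}  eq = contradiction (subst (_∈ P) eq (inside-P p i)) z∉P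
    distinct′ {suc i} {suc j} eq = cong suc (distinct p eq)
    inside′ : ∀ i → c′ i ∈ P ∪ ⁅ z ⁆
    inside′ zero    = q⊆p∪q P ⁅ z ⁆ (x∈⁅x⁆ z)
    inside′ (suc i) = p⊆p∪q ⁅ z ⁆ (inside-P p i)
    step′ : ∀ i → Adj (c′ (inject₁ i)) (c′ (suc i))
    step′ zero    = subst (Adj z) (sym (start p)) z~x
    step′ (suc i) = step p i

  -- If `x` and `y` differed, the path between them would close up through `z` to a cycle.
  acyclic⇒unique-neighbour : Acyclic G → ∀ {P x y z} → Path P x y → z ∉ P →
                             Adj z x → Adj z y → x ≡ y
  acyclic⇒unique-neighbour acyclic {x = x} {y} {z} p z∉P z~x z~y = go p
    where
    go : Path _ x y → x ≡ y
    go record { ℓ = zero ; start = start ; end = end } = trans (sym start) end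
    -- The path has at least two vertices here, so with `z` there are the three that `Cycle`
    -- requires.
    go p@record { ℓ = suc _ ; end = end } = contradiction (record
      { c = c q ; distinct = distinct q ; step = step q
      ; close = subst (λ u → Adj u z) (sym end) (Adj-sym z~y) }) acyclic
      where q = prepend z∉P z~x p

-- Greedy embedding of a tree with k edges: the image of the next leaf must
-- avoid φ x and at most k − 1 further vertices.
module Greedy {k n : ℕ} {G : Graph (suc k)} (tree : IsTree G)
              {E : Fin n → Fin n → Set} (E-sym : ∀ {x y} → E x y → E y x)
              {U : Subset n} (N : Fin n → Subset n)
              (N⊆U : ∀ {x} → N x ⊆ U) (N-irrefl : ∀ {x} → x ∉ N x)
              (N⇒E : ∀ {x y} → y ∈ N x → E x y)
              (large : ∀ {x} → x ∈ U → k ≤ ∣ N x ∣) where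
  open Graph G
  open IsTree tree

  -- The field `path` keeps `P` connected; together with acyclicity this makes every further vertex
  -- a leaf over `P`.
  record Partial (P : Subset (suc k)) : Set where
    field
      φ         : Fin (suc k) → Fin n
      φ∈U       : ∀ {x} → x ∈ P → φ x ∈ U
      injective : ∀ {x y} → x ∈ P → y ∈ P → φ x ≡ φ y → x ≡ y
      hom       : ∀ {x y} → x ∈ P → y ∈ P → Adj x y → E (φ x) (φ y)
      path      : ∀ {x y} → x ∈ P → y ∈ P → Path G P x y

  module Step {P : Subset (suc k)} (partial : Partial P) {x y : Fin (suc k)}
              (x∈P : x ∈ P) (y∉P : y ∉ P) (x~y : Adj x y) where
    open Partial partial

    Used : Fin n → Set
    Used w = ∃ λ z → z ∈ P × φ z ≡ w

    used? : ∀ w → Dec (Used w)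
    used? w = Fin.any? λ z → (z ∈? P) ×-dec (φ z Fin.≟ w)

    ∣P∣≤k : ∣ P ∣ ≤ k
    ∣P∣≤k = ℕ.≤-pred (subst (∣ P ∣ <_) (∣⊤∣≡n (suc k)) (p⊂q⇒∣p∣<∣q∣ (⊆⊤ , y , ∈⊤ , y∉P)))

    -- Pigeonhole: if all neighbours of `φ x` were used, they would have distinct preimages in
    -- `P - x`. That set has fewer than `k` elements, because `y` is missing from `P`.
    unused-neighbour : ∃ λ w → w ∈ N (φ x) × ¬ Used w
    unused-neighbour with Fin.any? (λ w → (w ∈? N (φ x)) ×-dec ¬? (used? w))
    ... | yes found = found
    ... | no  none  = contradiction (large (φ∈U x∈P)) (ℕ.<⇒≱ (begin-strict
      ∣ N (φ x) ∣  ≤⟨ ∣p∣≤∣q∣-injection (λ w z → φ z ≡ w) preimage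
                       (λ _ _ φz≡w φz≡w′ → trans (sym φz≡w) φz≡w′) ⟩
      ∣ P - x ∣    <⟨ x∈p⇒∣p-x∣<∣p∣ x∈P ⟩
      ∣ P ∣        ≤⟨ ∣P∣≤k ⟩
      k            ∎))
      where
      open ℕ.≤-Reasoning
      preimage : ∀ {w} → w ∈ N (φ x) → ∃ λ z → z ∈ P - x × φ z ≡ w
      preimage {w} w∈N with used? w
      ... | no ¬used = contradiction (w , w∈N , ¬used) none
      ... | yes (z , z∈P , refl) = z , x∈p∧x≢y⇒x∈p-y z∈P (λ { refl → N-irrefl w∈N }) , refl

    P⁺ : Subset (suc k)
    P⁺ = P ∪ ⁅ y ⁆

    y∈P⁺ : y ∈ P⁺
    y∈P⁺ = q⊆p∪q P ⁅ y ⁆ (x∈⁅x⁆ y)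

    P⊂P⁺ : P ⊂ P⁺
    P⊂P⁺ = p⊆p∪q ⁅ y ⁆ , y , y∈P⁺ , y∉P

    w : Fin n
    w = proj₁ unused-neighbour

    w∈N : w ∈ N (φ x)
    w∈N = proj₁ (proj₂ unused-neighbour)

    w-unused : ¬ Used w
    w-unused = proj₂ (proj₂ unused-neighbour)

    φ⁺ : Fin (suc k) → Fin n
    φ⁺ z with z Fin.≟ y
    ... | yes _ = w
    ... | no  _ = φ z

    φ⁺-y : φ⁺ y ≡ w
    φ⁺-y with y Fin.≟ y
    ... | yes _  = refl
    ... | no y≢y = contradiction refl y≢y

    φ⁺-P : ∀ {z} → z ∈ P → φ⁺ z ≡ φ z
    φ⁺-P {z} z∈P with z Fin.≟ y
    ... | yes refl = contradiction z∈P y∉P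
    ... | no _     = refl

    image : ∀ {z} → z ∈ P⁺ → (z ∈ P × φ⁺ z ≡ φ z) ⊎ (z ≡ y × φ⁺ z ≡ w)
    image z∈ with ∈-add⁻ z∈
    ... | inj₁ z∈P  = inj₁ (z∈P , φ⁺-P z∈P)
    ... | inj₂ refl = inj₂ (refl , φ⁺-y)

    -- The only neighbour of `y` in `P` is `x`, and `w` was chosen next to `φ x`.
    E-new : ∀ {z} → z ∈ P → Adj y z → E w (φ z)
    E-new z∈P y~z with refl ← acyclic⇒unique-neighbour G acyclic (path x∈P z∈P) y∉P (Adj-sym G x~y) y~z
      = E-sym (N⇒E w∈N)

    extended : Partial P⁺
    extended = record { φ = φ⁺ ; φ∈U = φ∈U⁺ ; injective = injective⁺ ; hom = hom⁺ ; path = path⁺ }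
      where
      φ∈U⁺ : ∀ {z} → z ∈ P⁺ → φ⁺ z ∈ U
      φ∈U⁺ z∈ with image z∈
      ... | inj₁ (z∈P , eq) = subst (_∈ U) (sym eq) (φ∈U z∈P)
      ... | inj₂ (_   , eq) = subst (_∈ U) (sym eq) (N⊆U w∈N)

      injective⁺ : ∀ {z z′} → z ∈ P⁺ → z′ ∈ P⁺ → φ⁺ z ≡ φ⁺ z′ → z ≡ z′
      injective⁺ z∈ z′∈ eq with image z∈ | image z′∈
      ... | inj₁ (z∈P , p)  | inj₁ (z′∈P , q) = injective z∈P z′∈P (trans (sym p) (trans eq q))
      ... | inj₁ (z∈P , p)  | inj₂ (refl , q) = contradiction (_ , z∈P , trans (sym p) (trans eq q)) w-unused
      ... | inj₂ (refl , p) | inj₁ (z′∈P , q) = contradiction (_ , z′∈P , trans (sym q) (trans (sym eq) p)) w-unused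
      ... | inj₂ (refl , _) | inj₂ (refl , _) = refl

      hom⁺ : ∀ {z z′} → z ∈ P⁺ → z′ ∈ P⁺ → Adj z z′ → E (φ⁺ z) (φ⁺ z′)
      hom⁺ z∈ z′∈ z~z′ with image z∈ | image z′∈
      ... | inj₁ (z∈P , p)  | inj₁ (z′∈P , q) = subst₂ E (sym p) (sym q) (hom z∈P z′∈P z~z′)
      ... | inj₁ (z∈P , p)  | inj₂ (refl , q) = subst₂ E (sym p) (sym q) (E-sym (E-new z∈P (Adj-sym G z~z′)))
      ... | inj₂ (refl , p) | inj₁ (z′∈P , q) = subst₂ E (sym p) (sym q) (E-new z′∈P z~z′)
      ... | inj₂ (refl , _) | inj₂ (refl , _) = contradiction refl (Adj⇒≢ G z~z′)

      path-from-y : ∀ {z} → z ∈ P → Path G P⁺ y z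
      path-from-y z∈P = prepend G y∉P (Adj-sym G x~y) (path x∈P z∈P)

      path⁺ : ∀ {z z′} → z ∈ P⁺ → z′ ∈ P⁺ → Path G P⁺ z z′
      path⁺ z∈ z′∈ with ∈-add⁻ z∈ | ∈-add⁻ z′∈
      ... | inj₁ z∈P  | inj₁ z′∈P = weaken-path G (p⊆p∪q ⁅ y ⁆) (path z∈P z′∈P)
      ... | inj₁ z∈P  | inj₂ refl = reverse G (path-from-y z∈P)
      ... | inj₂ refl | inj₁ z′∈P = path-from-y z′∈P
      ... | inj₂ refl | inj₂ refl = single G y∈P⁺

  Embedding : Set
  Embedding = Σ (Fin (suc k) → Fin n) λ φ →
    Injective _≡_ _≡_ φ × (∀ {x y} → Adj x y → E (φ x) (φ y))

  -- While a vertex is missing, connectedness gives an edge out of `P`, and its outer end is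
  -- attached.
  grow : ∀ {P} → Acc _⊃_ P → Nonempty P → Partial P → Embedding
  grow {P} (acc rec) (x₀ , x₀∈P) partial with Fin.all? (_∈? P)
  ... | yes full = φ , injective (full _) (full _) , hom (full _) (full _)
    where open Partial partial
  ... | no ¬full
    with y₀ , y₀∉P ← Fin.¬∀⟶∃¬ (suc k) (_∈ P) (_∈? P) ¬full
    with x , y , x∈P , y∉P , x~y ← crossing G (connected x₀ y₀) x₀∈P y₀∉P =
    grow (rec P⊂P⁺) (y , y∈P⁺) extended
    where open Step partial x∈P y∉P x~y

  embedding : Nonempty U → Embedding
  embedding (u , u∈U) = grow (⊃-wellFounded ⁅ zero ⁆) (zero , x∈⁅x⁆ zero) (record
    -- Only the value at `zero` matters yet; `grow` overwrites the others.
    { φ         = λ _ → u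
    ; φ∈U       = λ _ → u∈U
    ; injective = λ x∈ y∈ _ → trans (is-zero x∈) (sym (is-zero y∈))
    ; hom       = λ x∈ y∈ x~y → contradiction (trans (is-zero x∈) (sym (is-zero y∈))) (Adj⇒≢ G x~y)
    ; path      = path₀
    })
    where
    is-zero : {x : Fin (suc k)} → x ∈ ⁅ zero ⁆ → x ≡ zero
    is-zero = x∈⁅y⁆⇒x≡y zero
    path₀ : ∀ {x y} → x ∈ ⁅ zero ⁆ → y ∈ ⁅ zero ⁆ → Path G ⁅ zero ⁆ x y
    path₀ x∈ y∈ with refl ← is-zero x∈ | refl ← is-zero y∈ = single G x∈

-- Counting hyperedges

module Peeling {m n : ℕ} (t : Fin m → Subset n) where

  Around : Subset n → Fin n → Fin m → Set
  Around U v a = v ∈ t a × t a ⊆ U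

  around? : ∀ U v → Decidable (Around U v)
  around? U v a = (v ∈? t a) ×-dec (t a ⊆? U)

  around : Subset n → Fin n → Subset m
  around U v = comprehension (around? U v)

  within : Subset n → Subset m
  within U = comprehension (λ a → t a ⊆? U)

  module _ (nonempty : ∀ a → Nonempty (t a)) (c : ℕ)
           (sparse : ∀ U → Nonempty U → ∃ λ v → v ∈ U × ∣ around U v ∣ ≤ c) where

    -- Peel off the vertex given by `sparse`: at most `c` of the sets inside `U` contain it, and the
    -- others lie in `U - v`.
    within-bound : ∀ U → Acc _⊂_ U → ∣ within U ∣ ≤ c * ∣ U ∣
    within-bound U (acc rec) with nonempty? U
    ... | no empty = ℕ.≤-trans
      (∣p∣≤∣q∣-injection {q = []} (λ _ _ → Fin 0) none (λ _ _ ())) z≤n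
      where
      -- Only an empty set fits into the empty `U`, and no `t a` is empty.
      none : ∀ {a} → a ∈ within U → ∃ λ y → y ∈ [] × Fin 0
      none {a} a∈ = let x , x∈ = nonempty a in
        contradiction (x , ∈-comprehension⁻ (λ a → t a ⊆? U) a∈ x∈) empty
    ... | yes ne with v , v∈U , around≤c ← sparse U ne = begin
      ∣ within U ∣                                    ≡⟨ ∣p∣≡∣p∩q∣+∣p∩∁q∣ (within U) (around U v) ⟩
      ∣ within U ∩ around U v ∣ + ∣ within U ∩ ∁ (around U v) ∣
        ≤⟨ ℕ.+-mono-≤ (∣p∩q∣≤∣q∣ (within U) (around U v)) (p⊆q⇒∣p∣≤∣q∣ rest) ⟩
      ∣ around U v ∣ + ∣ within (U - v) ∣
        ≤⟨ ℕ.+-mono-≤ around≤c (within-bound (U - v) (rec (x∈p⇒p-x⊂p v∈U))) ⟩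
      c + c * ∣ U - v ∣                               ≡⟨ ℕ.*-suc c ∣ U - v ∣ ⟨
      c * suc ∣ U - v ∣                               ≡⟨ cong (c *_) (x∈p⇒1+∣p-x∣≡∣p∣ v∈U) ⟩
      c * ∣ U ∣                                       ∎
      where
      open ℕ.≤-Reasoning
      rest : within U ∩ ∁ (around U v) ⊆ within (U - v)
      rest {a} a∈ with a∈W , a∈∁ ← x∈p∩q⁻ (within U) (∁ (around U v)) a∈ =
        ∈-comprehension⁺ (λ a → t a ⊆? (U - v)) λ x∈ →
          x∈p∧x≢y⇒x∈p-y (sub x∈)
            λ { refl → x∈∁p⇒x∉p a∈∁ (∈-comprehension⁺ (around? U v) (x∈ , sub)) }
        where
        sub : t a ⊆ U
        sub = ∈-comprehension⁻ (λ a → t a ⊆? U) a∈W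

    peeling-bound : m ≤ c * n
    peeling-bound = begin
      m              ≡⟨ ∣⊤∣≡n m ⟨
      ∣ ⊤ {m} ∣      ≤⟨ p⊆q⇒∣p∣≤∣q∣ {p = ⊤} {q = within ⊤} (λ _ → ∈-comprehension⁺ (λ a → t a ⊆? ⊤) λ _ → ∈⊤) ⟩
      ∣ within ⊤ ∣   ≤⟨ within-bound ⊤ (⊂-wellFounded ⊤) ⟩
      c * ∣ ⊤ {n} ∣  ≡⟨ cong (c *_) (∣⊤∣≡n n) ⟩
      c * n          ∎
      where open ℕ.≤-Reasoning

p-x≡q-x⇒p≡q : ∀ {n} {p q : Subset n} {x} → x ∈ p → x ∈ q → p - x ≡ q - x → p ≡ q
p-x≡q-x⇒p≡q {x = x} x∈p x∈q eq = ⊆-antisym (half x∈q eq) (half x∈p (sym eq))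
  where
  half : ∀ {p q} → x ∈ q → p - x ≡ q - x → p ⊆ q
  half {p} {q} x∈q eq {y} y∈p with y Fin.≟ x
  ... | yes refl = x∈q
  ... | no y≢x   = proj₁ (x∈p-y⁻ q (subst (y ∈_) eq (x∈p∧x≢y⇒x∈p-y y∈p y≢x)))

-- Here k = d + 1 and r = s + 2.
module BergeTreeFree {n d s : ℕ} {T : Graph (suc (suc d))} (tree : IsTree T)
                     (H : Hypergraph n) (uniform : Uniform (suc (suc s)) H)
                     (berge-free : BergeFree T H) where
  open Graph T using (Adj)

  hyperedge : Fin (size H) → Subset n
  hyperedge = List.lookup (edges H)

  ∣hyperedge∣ : ∀ a → ∣ hyperedge a ∣ ≡ suc (suc s)
  ∣hyperedge∣ a = All.lookup uniform (List∈.∈-lookup a)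

  Shadow : Fin (size H) → Subset n → Set
  Shadow a b = ∣ b ∣ ≡ 2 × b ⊆ hyperedge a

  shadow? : ∀ a → Decidable (Shadow a)
  shadow? a b = (∣ b ∣ ℕ.≟ 2) ×-dec (b ⊆? hyperedge a)

  open König _≟ˢ_ anySubset? shadow?
  open Matching
  open Cover cover

  -- Adjacency in the graph G of matched pairs.
  Linked : Fin n → Fin n → Set
  Linked x y = ∃ λ a → partner M a ≡ just (pair x y)

  linked? : ∀ x y → Dec (Linked x y)
  linked? x y = Fin.any? λ a → Maybe.≡-dec _≟ˢ_ (partner M a) (just (pair x y))

  Linked-sym : ∀ {x y} → Linked x y → Linked y x
  Linked-sym {x} {y} (a , p) = a , trans p (cong just (pair-comm x y))

  -- Each tree edge is sent to the hyperedge matched with its image pair. A hyperedge has only one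
  -- partner, so equal hyperedges give equal pairs, and injectivity of `φ` recovers the tree edge.
  no-embedding : (φ : Fin (suc (suc d)) → Fin n) → Injective _≡_ _≡_ φ →
                 ¬ (∀ {x y} → Adj x y → Linked (φ x) (φ y))
  no-embedding φ φ-inj hom = berge-free (φ , f , record
    { φ-injective = φ-inj
    ; f-injective = λ {e} {e′} eq → same-ends e e′ (Maybe.just-injective (trans
        (sym (matched e)) (trans (cong (partner M) (lookup-injective (simple H) eq)) (matched e′))))
    ; f-edge      = λ e → List∈.∈-lookup (label e)
    ; f-contains  = λ e → covers e (x∈pair _ _) , covers e (y∈pair _ _)
    })
    where
    label : Edge T → Fin (size H)
    label e = proj₁ (hom (adjacent e))
    f : Edge T → Subset n
    f = hyperedge ∘ label
    ends : Edge T → Subset n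
    ends e = pair (φ (end₁ e)) (φ (end₂ e))
    matched : ∀ e → partner M (label e) ≡ just (ends e)
    matched e = proj₂ (hom (adjacent e))
    covers : ∀ e → ends e ⊆ f e
    covers e = proj₂ (sound M (matched e))
    endpoint : ∀ e x → φ x ∈ ends e → x ≡ end₁ e ⊎ x ≡ end₂ e
    endpoint e x x∈ with ∈-pair⁻ x∈
    ... | inj₁ eq = inj₁ (φ-inj eq)
    ... | inj₂ eq = inj₂ (φ-inj eq)
    same-ends : ∀ e e′ → ends e ≡ ends e′ → e ≡ e′
    same-ends e e′ eq
      with endpoint e′ (end₁ e) (subst (φ (end₁ e) ∈_) eq (x∈pair _ _))
         | endpoint e′ (end₂ e) (subst (φ (end₂ e) ∈_) eq (y∈pair _ _))
    ... | inj₁ p | inj₂ q = edge-≡ p q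
    -- In the remaining cases the two ends would coincide or be interchanged, against `ordered`.
    ... | inj₁ p | inj₁ q = contradiction (ordered e) (Fin.<-irrefl (trans p (sym q)))
    ... | inj₂ p | inj₂ q = contradiction (ordered e) (Fin.<-irrefl (trans p (sym q)))
    ... | inj₂ p | inj₁ q = contradiction (subst₂ Fin._<_ p q (ordered e)) (Fin.<-asym (ordered e′))

  Neighbour : Subset n → Fin n → Fin n → Set
  Neighbour U x y = y ∈ U × y ≢ x × Linked x y

  neighbour? : ∀ U x → Decidable (Neighbour U x)
  neighbour? U x y = (y ∈? U) ×-dec (¬? (y Fin.≟ x) ×-dec linked? x y)

  neighbours : Subset n → Fin n → Subset n
  neighbours U x = comprehension (neighbour? U x)

  low-degree : ∀ U → Nonempty U → ∃ λ v → v ∈ U × ∣ neighbours U v ∣ ≤ d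
  low-degree U ne with Fin.any? (λ v → (v ∈? U) ×-dec (∣ neighbours U v ∣ ℕ.≤? d))
  ... | yes found = found
  ... | no  none  = let φ , φ-inj , hom = embedding ne in ⊥-elim (no-embedding φ φ-inj hom)
    where
    open Greedy tree {E = Linked} Linked-sym {U} (neighbours U)
      (λ y∈ → proj₁ (∈-comprehension⁻ (neighbour? U _) y∈))
      (λ x∈ → proj₁ (proj₂ (∈-comprehension⁻ (neighbour? U _) x∈)) refl)
      (λ y∈ → proj₂ (proj₂ (∈-comprehension⁻ (neighbour? U _) y∈)))
      -- More than `d` neighbours means at least `suc d`, the number of edges of the tree.
      (λ v∈U → ℕ.≰⇒> λ ≤d → none (_ , v∈U , ≤d))

  -- The set that stands for a hyperedge in the count: the hyperedge itself in `W`, its matched pair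
  -- outside. That pair exists because `free⊆W`.
  trace-cases : ∀ a → ∃ λ t → (a ∈ W × t ≡ hyperedge a) ⊎ (a ∉ W × partner M a ≡ just t)
  trace-cases a with a ∈? W | partner M a in eq
  ... | yes a∈W | _       = hyperedge a , inj₁ (a∈W , refl)
  ... | no  a∉W | just b  = b , inj₂ (a∉W , refl)
  ... | no  a∉W | nothing = contradiction (free⊆W eq) a∉W

  trace : Fin (size H) → Subset n
  trace = proj₁ ∘ trace-cases

  trace-W : ∀ {a} → a ∈ W → trace a ≡ hyperedge a
  trace-W {a} a∈W with trace-cases a
  ... | _ , inj₁ (_   , eq) = eq
  ... | _ , inj₂ (a∉W , _)  = contradiction a∈W a∉W

  trace-∁W : ∀ {a} → a ∉ W → partner M a ≡ just (trace a)
  trace-∁W {a} a∉W with trace-cases a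
  ... | _ , inj₁ (a∈W , _)  = contradiction a∈W a∉W
  ... | _ , inj₂ (_   , eq) = eq

  trace-nonempty : ∀ a → Nonempty (trace a)
  trace-nonempty a with trace-cases a
  ... | t , inj₁ (_ , refl) = ∣p∣≡suc⇒Nonempty t (∣hyperedge∣ a)
  ... | t , inj₂ (_ , eq)   = ∣p∣≡suc⇒Nonempty t (proj₁ (sound M eq))

  open Peeling trace

  module LocalBound (U : Subset n) (v : Fin n) where

    -- The neighbours of `v` that are not blue are the red ones: their pairs with `v` are matched
    -- only into `W`.
    Blue : Fin n → Set
    Blue w = ∃ λ a → a ∉ W × partner M a ≡ just (pair v w)

    blue? : Decidable Blue
    blue? w = Fin.any? λ a → ¬? (a ∈? W) ×-dec Maybe.≡-dec _≟ˢ_ (partner M a) (just (pair v w))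

    N X : Subset n
    N = neighbours U v
    X = comprehension blue?

    -- Outside `W` a trace through `v` is a matched pair; its other end is a blue neighbour, which
    -- determines the hyperedge because the matching is injective.
    blue-bound : ∣ around U v ∩ ∁ W ∣ ≤ ∣ N ∩ X ∣
    blue-bound = ∣p∣≤∣q∣-injection (λ a w → partner M a ≡ just (pair v w)) total
      (λ _ _ → injective M)
      where
      total : ∀ {a} → a ∈ around U v ∩ ∁ W → ∃ λ w → w ∈ N ∩ X × partner M a ≡ just (pair v w)
      total {a} a∈
        with a∈around , a∈∁W ← x∈p∩q⁻ (around U v) (∁ W) a∈
        with v∈t , t⊆U ← ∈-comprehension⁻ (around? U v) a∈around
        with w , w≢v , t≡pair ← ∣p∣≡2⇒pair (proj₁ (sound M (trace-∁W (x∈∁p⇒x∉p a∈∁W)))) v∈t =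
        w , x∈p∩q⁺ ( ∈-comprehension⁺ (neighbour? U v) (w∈U , w≢v , a , eq)
                   , ∈-comprehension⁺ blue? (a , a∉W , eq)) , eq
        where
        a∉W : a ∉ W
        a∉W = x∈∁p⇒x∉p a∈∁W
        eq : partner M a ≡ just (pair v w)
        eq = trans (trace-∁W a∉W) (cong just t≡pair)
        w∈U : w ∈ U
        w∈U = t⊆U (subst (w ∈_) (sym t≡pair) (y∈pair v w))

    -- By `closed`, every pair of `v` with another vertex of a hyperedge in `W` is matched into `W`.
    -- Without `v`, such a hyperedge is thus a set of `suc s` red neighbours, and it can be
    -- recovered from that set.
    red-bound : ∣ around U v ∩ W ∣ ≤ ∣ N ∩ ∁ X ∣ C suc s
    red-bound = ∣family∣≤C (N ∩ ∁ X) (suc s) (around U v ∩ W) (λ a → hyperedge a - v)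
      clique
      (λ a∈ → ℕ.suc-injective (trans (x∈p⇒1+∣p-x∣≡∣p∣ (proj₁ (split a∈))) (∣hyperedge∣ _)))
      λ a∈ b∈ eq → lookup-injective (simple H)
        (p-x≡q-x⇒p≡q (proj₁ (split a∈)) (proj₁ (split b∈)) eq)
      where
      split : ∀ {a} → a ∈ around U v ∩ W → v ∈ hyperedge a × hyperedge a ⊆ U × a ∈ W
      split {a} a∈
        with a∈around , a∈W ← x∈p∩q⁻ (around U v) W a∈
        with v∈t , t⊆U ← ∈-comprehension⁻ (around? U v) a∈around =
        subst (v ∈_) (trace-W a∈W) v∈t , subst (_⊆ U) (trace-W a∈W) t⊆U , a∈W

      clique : ∀ {a} → a ∈ around U v ∩ W → hyperedge a - v ⊆ N ∩ ∁ X
      clique {a} a∈ {w} w∈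
        with v∈h , h⊆U , a∈W ← split a∈
        with w∈h , w≢v ← x∈p-y⁻ (hyperedge a) w∈
        with a′ , a′∈W , eq ← closed a∈W (∣pair∣≡2 (w≢v ∘ sym) , pair⊆ v∈h w∈h) =
        x∈p∩q⁺ ( ∈-comprehension⁺ (neighbour? U v) (h⊆U w∈h , w≢v , a′ , eq)
               , x∉p⇒x∈∁p λ w∈X → not-blue (∈-comprehension⁻ blue? w∈X))
        where
        not-blue : ¬ Blue w
        not-blue (a″ , a″∉W , eq″) = a″∉W (subst (_∈ W) (injective M eq eq″) a′∈W)

    local-bound : ∣ around U v ∣ ≤ ∣ N ∩ X ∣ + ∣ N ∩ ∁ X ∣ C suc s
    local-bound = begin
      ∣ around U v ∣                                ≡⟨ ∣p∣≡∣p∩q∣+∣p∩∁q∣ (around U v) W ⟩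
      ∣ around U v ∩ W ∣ + ∣ around U v ∩ ∁ W ∣       ≤⟨ ℕ.+-mono-≤ red-bound blue-bound ⟩
      ∣ N ∩ ∁ X ∣ C suc s + ∣ N ∩ X ∣             ≡⟨ ℕ.+-comm _ ∣ N ∩ X ∣ ⟩
      ∣ N ∩ X ∣ + ∣ N ∩ ∁ X ∣ C suc s             ∎
      where open ℕ.≤-Reasoning

  -- `b` and `R` stand for the numbers of blue and red neighbours of a vertex of low degree; `c`
  -- must cover every way to split them.
  size-bound : ∀ c → (∀ b R → b + R ≤ d → b + R C suc s ≤ c) → size H ≤ c * n
  size-bound c bound = peeling-bound trace-nonempty c λ U ne →
    let v , v∈U , N≤d = low-degree U ne
        open LocalBound U v
    in v , v∈U , ℕ.≤-trans local-bound
         (bound ∣ N ∩ X ∣ ∣ N ∩ ∁ X ∣ (ℕ.≤-trans (ℕ.≤-reflexive (sym (∣p∣≡∣p∩q∣+∣p∩∁q∣ N X))) N≤d))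

-- Supplies the edge that `ex-isMaximum` asks for: a walk between two distinct vertices has to leave
-- the first one.
tree-edge : ∀ {d} {T : Graph (suc (suc d))} → IsTree T → Edge T
tree-edge {T = T} tree
  with x , y , _ , _ , x~y ← crossing T (IsTree.connected tree zero (suc zero)) (x∈⁅x⁆ zero)
                               (λ 1∈ → Fin.0≢1+n (sym (x∈⁅y⁆⇒x≡y zero 1∈)))
  with Fin.<-cmp x y
... | tri< x<y _ _ = edge x y x<y x~y
... | tri≈ _ x≡y _ = contradiction x≡y (Adj⇒≢ T x~y)
... | tri> _ _ y<x = edge y x y<x (Adj-sym T x~y)

ex-bound : ∀ {n d s} {T : Graph (suc (suc d))} → IsTree T → ∀ c →
           (∀ b R → b + R ≤ d → b + R C suc s ≤ c) → ex (suc (suc s)) n T ≤ c * n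
ex-bound {n} {d} {s} {T} tree c bound
  with (H , uniform , berge-free , size≡) , _ ← ex-isMaximum (suc (suc s)) n T (tree-edge tree) =
  subst (_≤ c * n) size≡ (BergeTreeFree.size-bound tree H uniform berge-free c bound)

-- Binomial estimates

pascal : ∀ n s → suc n C suc s ≡ n C s + n C suc s
pascal n s = sym (nCk+nC[k+1]≡[n+1]C[k+1] n s)

s≤n⇒1≤nCs : ∀ {n s} → s ≤ n → 1 ≤ n C s
s≤n⇒1≤nCs {n}     {zero}  _         = s≤s z≤n
s≤n⇒1≤nCs {suc n} {suc s} (s≤s s≤n) =
  ℕ.≤-trans (s≤n⇒1≤nCs s≤n) (ℕ.≤-trans (ℕ.m≤m+n _ _) (ℕ.≤-reflexive (sym (pascal n s))))

C-monoˡ-≤ : ∀ s d n → n C s ≤ (d + n) C s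
C-monoˡ-≤ s       zero    n = ℕ.≤-refl
C-monoˡ-≤ zero    (suc d) n = ℕ.≤-refl
C-monoˡ-≤ (suc s) (suc d) n = ℕ.≤-trans (C-monoˡ-≤ (suc s) d n)
  (ℕ.≤-trans (ℕ.m≤n+m _ _) (ℕ.≤-reflexive (sym (pascal (d + n) s))))

-- Pascal's rule: one summand provides `n` by induction, the other at least 1. In the boundary case,
-- where the second binomial is `n C n`, the summands exchange roles.
n≤nC[1+s] : ∀ {n s} → suc s < n → n ≤ n C suc s
n≤nC[1+s] {n}     {zero}  _         = ℕ.≤-reflexive (sym (nC1≡n n))
n≤nC[1+s] {suc n} {suc s} (s≤s s+2≤n) rewrite pascal n (suc s) with suc (suc s) ℕ.≟ n
... | yes refl = begin
  suc n                         ≡⟨ ℕ.+-comm 1 n ⟩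
  n + 1                         ≤⟨ ℕ.+-mono-≤ (n≤nC[1+s] s+2≤n) (ℕ.≤-reflexive (sym (nCn≡1 n))) ⟩
  n C suc s + n C n             ∎
  where open ℕ.≤-Reasoning
... | no s+2≢n = ℕ.+-mono-≤ (s≤n⇒1≤nCs (ℕ.<⇒≤ s+2≤n)) (n≤nC[1+s] (ℕ.≤∧≢⇒< s+2≤n s+2≢n))

-- Each additional element raises the binomial by at least 1, since `s` is at most the number of
-- elements already present.
b+RCs≤[b+R]Cs : ∀ b {R s} → s < R → b + R C suc s ≤ (b + R) C suc s
b+RCs≤[b+R]Cs zero            s<R = ℕ.≤-refl
b+RCs≤[b+R]Cs (suc b) {R} {s} s<R = begin
  1 + (b + R C suc s)                   ≤⟨ ℕ.+-mono-≤ (s≤n⇒1≤nCs (ℕ.≤-trans (ℕ.<⇒≤ s<R) (ℕ.m≤n+m R b)))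
                                                      (b+RCs≤[b+R]Cs b s<R) ⟩
  (b + R) C s + (b + R) C suc s         ≡⟨ pascal (b + R) s ⟨
  suc (b + R) C suc s                   ∎
  where open ℕ.≤-Reasoning

-- For `s < R` all blue neighbours may be recoloured red. Otherwise the binomial in `R` vanishes and
-- only `b`, at most `d`, remains.
b+RCs≤dCs : ∀ b R {d s} → b + R ≤ d → suc s < d → b + R C suc s ≤ d C suc s
b+RCs≤dCs b R {d} {s} b+R≤d s<d with s ℕ.<? R
... | yes s<R = begin
  b + R C suc s              ≤⟨ b+RCs≤[b+R]Cs b s<R ⟩
  (b + R) C suc s            ≤⟨ C-monoˡ-≤ (suc s) (d ∸ (b + R)) (b + R) ⟩
  (d ∸ (b + R) + (b + R)) C suc s ≡⟨ cong (_C suc s) (ℕ.m∸n+n≡m b+R≤d) ⟩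
  d C suc s                  ∎
  where open ℕ.≤-Reasoning
... | no s≮R = begin
  b + R C suc s              ≡⟨ cong (_+_ b) (k>n⇒nCk≡0 (s≤s (ℕ.≮⇒≥ s≮R))) ⟩
  b + 0                      ≤⟨ ℕ.+-monoʳ-≤ b z≤n ⟩
  b + R                      ≤⟨ b+R≤d ⟩
  d                          ≤⟨ n≤nC[1+s] s<d ⟩
  d C suc s                  ∎
  where open ℕ.≤-Reasoning

-- Here `R` is at most `suc s`, so its binomial is 1 or 0 and does not exceed `R`.
b+RCs≤d : ∀ b R {d s} → b + R ≤ d → d ≤ suc s → b + R C suc s ≤ d
b+RCs≤d b R {d} {s} b+R≤d d≤s = ℕ.≤-trans (ℕ.+-monoʳ-≤ b RCs≤R) b+R≤d
  where
  RCs≤R : R C suc s ≤ R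
  RCs≤R with R ℕ.≟ suc s
  ... | yes refl = ℕ.≤-trans (ℕ.≤-reflexive (nCn≡1 R)) (s≤s z≤n)
  ... | no R≢s   = ℕ.≤-trans (ℕ.≤-reflexive (k>n⇒nCk≡0 (ℕ.≤∧≢⇒<
    (ℕ.≤-trans (ℕ.m≤n+m R b) (ℕ.≤-trans b+R≤d d≤s)) R≢s))) z≤n

-- Pascal's rule splits the left binomial; the two induction hypotheses share the factor `suc n` and
-- recombine by the same rule.
absorption : ∀ n s → suc s * (suc n C suc s) ≡ suc n * (n C s)
absorption zero    zero    = refl
absorption zero    (suc s) = trans (cong (suc (suc s) *_) (k>n⇒nCk≡0 (s<s (z<s {s}))))
                                   (ℕ.*-zeroʳ (suc (suc s)))
absorption (suc n) zero    = trans (ℕ.*-identityˡ _) (trans (nC1≡n (suc (suc n))) (sym (ℕ.*-identityʳ _)))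
absorption (suc n) (suc s) = begin
  suc (suc s) * (suc (suc n) C suc (suc s))
    ≡⟨ cong (suc (suc s) *_) (pascal (suc n) (suc s)) ⟩
  suc (suc s) * (B + suc n C suc (suc s))
    ≡⟨ ℕ.*-distribˡ-+ (suc (suc s)) B _ ⟩
  B + suc s * B + suc (suc s) * (suc n C suc (suc s))
    ≡⟨ cong₂ (λ x y → B + x + y) (absorption n s) (absorption n (suc s)) ⟩
  B + suc n * (n C s) + suc n * (n C suc s)
    ≡⟨ ℕ.+-assoc B _ _ ⟩
  B + (suc n * (n C s) + suc n * (n C suc s))
    ≡⟨ cong (_+_ B) (ℕ.*-distribˡ-+ (suc n) (n C s) (n C suc s)) ⟨
  B + suc n * (n C s + n C suc s)
    ≡⟨ cong (λ x → B + suc n * x) (pascal n s) ⟨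
  suc (suc n) * B ∎
  where
  open ≡-Reasoning
  B = suc n C suc s

-- Rational form of the bound

-- The prefix +_ clashes with sums of cardinalities ∣ p ∣ + ∣ q ∣, so it is opened only here.
open import Data.Integer using (+_)
import Data.Integer as ℤ
import Data.Integer.Properties as ℤ
open import Data.Rational using (_/_; toℚᵘ) renaming (_≤_ to _≤ℚ_; _*_ to _*ℚ_)
import Data.Rational.Properties as ℚ
open import Data.Rational.Unnormalised using (mkℚᵘ; *≤*) renaming (_*_ to _*ᵘ_)
import Data.Rational.Unnormalised.Properties as ℚᵘ

-- Among unnormalised rationals the product has the literal denominator `suc k * 1 * 1`, so the
-- inequality is the hypothesis after cross-multiplication.
≤-fraction : ∀ m a c n k → m * suc k ≤ a * c * n →
  (+ m / 1) ≤ℚ (+ a / suc k) *ℚ (+ c / 1) *ℚ (+ n / 1)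
≤-fraction m a c n k m*k≤acn = ℚ.toℚᵘ-cancel-≤ (begin
  toℚᵘ (+ m / 1)                                       ≃⟨ ℚ.toℚᵘ-fromℚᵘ (mkℚᵘ (+ m) 0) ⟩
  mkℚᵘ (+ m) 0                                         ≤⟨ *≤* integers ⟩
  mkℚᵘ (+ a) k *ᵘ mkℚᵘ (+ c) 0 *ᵘ mkℚᵘ (+ n) 0
    ≃⟨ ℚᵘ.*-cong (ℚᵘ.*-cong (ℚ.toℚᵘ-fromℚᵘ (mkℚᵘ (+ a) k)) (ℚ.toℚᵘ-fromℚᵘ (mkℚᵘ (+ c) 0)))
                 (ℚ.toℚᵘ-fromℚᵘ (mkℚᵘ (+ n) 0)) ⟨
  toℚᵘ (+ a / suc k) *ᵘ toℚᵘ (+ c / 1) *ᵘ toℚᵘ (+ n / 1)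
    ≃⟨ ℚᵘ.*-congʳ (ℚ.toℚᵘ-homo-* (+ a / suc k) (+ c / 1)) ⟨
  toℚᵘ ((+ a / suc k) *ℚ (+ c / 1)) *ᵘ toℚᵘ (+ n / 1)
    ≃⟨ ℚ.toℚᵘ-homo-* ((+ a / suc k) *ℚ (+ c / 1)) (+ n / 1) ⟨
  toℚᵘ ((+ a / suc k) *ℚ (+ c / 1) *ℚ (+ n / 1))       ∎)
  where
  open ℚᵘ.≤-Reasoning
  integers : + m ℤ.* + (suc k * 1 * 1) ℤ.≤ + a ℤ.* + c ℤ.* + n ℤ.* + 1
  integers = subst₂ ℤ._≤_
    (trans (cong (λ j → + (m * j)) (sym (trans (ℕ.*-identityʳ _) (ℕ.*-identityʳ _)))) (ℤ.pos-* m _))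
    (sym (trans (ℤ.*-identityʳ _) (trans (cong (ℤ._* + n) (sym (ℤ.pos-* a c))) (sym (ℤ.pos-* (a * c) n)))))
    (ℤ.+≤+ m*k≤acn)

ex-scaled : ∀ e n d s → e ≤ (d C suc s) * n →
            e * suc d ≤ 2 * suc s * (suc d C suc (suc s)) * n
ex-scaled e n d s e≤ = begin
  e * suc d                                  ≤⟨ ℕ.*-monoˡ-≤ (suc d) e≤ ⟩
  (d C suc s) * n * suc d                    ≡⟨ ℕ.*-comm _ (suc d) ⟩
  suc d * ((d C suc s) * n)                  ≡⟨ ℕ.*-assoc (suc d) (d C suc s) n ⟨
  suc d * (d C suc s) * n                    ≡⟨ cong (_* n) (absorption d (suc s)) ⟨
  suc (suc s) * (suc d C suc (suc s)) * n    ≤⟨ ℕ.*-monoˡ-≤ n (ℕ.*-monoˡ-≤ (suc d C suc (suc s)) r≤2[r-1]) ⟩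
  2 * suc s * (suc d C suc (suc s)) * n      ∎
  where
  open ℕ.≤-Reasoning
  r≤2[r-1] : suc (suc s) ≤ 2 * suc s
  r≤2[r-1] = s≤s (ℕ.≤-trans (ℕ.m≤n+m (suc s) s) (ℕ.≤-reflexive (cong (λ x → s + suc x) (sym (ℕ.+-identityʳ s)))))

proposition11 : (k r n : ℕ) .{{_ : NonZero k}} .{{_ : NonZero n}} → 2 ≤ r →
    (T : Graph (suc k)) → IsTree T →
    (r < k →
    (+ ex r n T / 1) ≤ℚ (+ (2 * (r ∸ 1)) / k) *ℚ (+ (k C r) / 1) *ℚ (+ n / 1))
    × (k ≤ r → ex r n T ≤ (k ∸ 1) * n)
proposition11 (suc d) (suc (suc s)) n (s≤s (s≤s z≤n)) T tree =
  -- Here `d` is k - 1 and `s` is r - 2: the assumption becomes `suc s < d`, and c is C(k - 1, r -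
  -- 1).
  (λ { (s≤s r≤d) → ≤-fraction (ex (suc (suc s)) n T) (2 * suc s) (suc d C suc (suc s)) n d
         (ex-scaled _ n d s (ex-bound tree (d C suc s) λ b R b+R≤d → b+RCs≤dCs b R b+R≤d r≤d)) }) ,
  -- The assumption becomes `d ≤ suc s`, and c is `d` itself.
  (λ { (s≤s d≤r) → ex-bound tree d λ b R b+R≤d → b+RCs≤d b R b+R≤d d≤r })
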